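{- Let $\mathcal{C}$ be a class of ontologies with $\textsc{cert-eval}[\mathcal{C}]$ decidable. If $\mathcal{C}\supseteq\mathsf{Af\text{ - }Inds}$, then $\mathsf{Datalog}\subseteq\mathsf{Dyadic}\text{ - }\mathcal{C}$.
   Context: A TGD is $\sigma:\Phi(\mathbf{x},\mathbf{y})\to\exists\mathbf{z}\,\Psi(\mathbf{x},\mathbf{z})$; an ontology is a finite set of TGDs; a datalog rule has no existential variables and a single head atom; $\mathsf{Datalog}$ is the class of ontologies of datalog rules. $\mathsf{Inclusion\text{ - }Dependencies}$: ontologies whose rules have exactly one body atom and one head atom, with no variable repeated within the body atom nor within the head atom. $\mathsf{Af\text{ - }Inds}$: ontologies in $\mathsf{Inclusion\text{ - }Dependencies}$ with no existential variables and in which no head predicate occurs in any rule body. Affected positions: for existential variable $z$, a position $\pi$ is $z$-affected if some rule has $z$ in its head at $\pi$, or some rule has a frontier variable in its head at $\pi$ occurring in its body only at $z$-affected positions; $\mathrm{aff}(\pi)$ is the set of such $z$. A body variable at positions $\pi_1,\dots,\pi_n$ is harmless if $\bigcap_i\mathrm{aff}(\pi_i)=\emptyset$, harmful otherwise; a harmful frontier variable is dangerous. For $\sigma\in\Sigma$, a body atom is $\sigma$-problematic if it contains a dangerous variable or shares a harmful variable with a $\sigma$-problematic atom; $\mathrm{p\text{ - }atoms}(\sigma)$ are these, $\mathrm{s\text{ - }atoms}(\sigma)$ the rest. $\mathrm{HF}(\sigma)$ = harmless frontier variables in $\mathrm{s\text{ - }atoms}(\sigma)$; $\mathrm{bridge}(\sigma)=(\mathrm{vars}(\mathrm{p\text{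 - }atoms}(\sigma))\cap\mathrm{vars}(\mathrm{s\text{ - }atoms}(\sigma)))\cup\mathrm{HF}(\sigma)$. With a fresh predicate $\mathrm{Aux}_\sigma$: $\mathrm{main}(\sigma):\mathrm{Aux}_\sigma(\mathrm{bridge}(\sigma)),\mathrm{p\text{ - }atoms}(\sigma)\to\exists\,\mathrm{exvars}(\sigma)\,\mathrm{head}(\sigma)$ (if a bridge variable occurs several times in the head, the corresponding $\mathrm{Aux}_\sigma$ argument positions are given distinct variables so that no variable is repeated), $\mathrm{main}(\Sigma)=\bigcup_{\sigma}\mathrm{main}(\sigma)$. $\Sigma\in\mathsf{Dyadic}\text{ - }\mathcal{C}$ iff $\Sigma\in\mathcal{C}$ or $\mathrm{main}(\Sigma)\in\mathcal{C}$. -}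

module Defs where

open import Data.Fin using (Fin)
import Data.Fin.Properties as Fin
open import Data.List using (List; []; _∷_; _++_; map; concatMap; filter; deduplicate;
  allFin; length; cartesianProduct; removeAt)
import Data.List.Properties as List
open import Data.List.Extrema.Nat using (max)
open import Data.List.Membership.Propositional using (_∈_; _∉_; find; lose)
open import Data.List.Membership.Propositional.Properties
  using (∈-map⁺; ∈-map⁻; ∈-concatMap⁺; ∈-concatMap⁻; ∈-++⁺ˡ; ∈-++⁺ʳ; ∈-++⁻;
         ∈-filter⁺; ∈-filter⁻; ∈-cartesianProduct⁺; ∈-cartesianProduct⁻)
open import Data.List.Relation.Unary.All using (All; []; _∷_; all?)
import Data.List.Relation.Unary.All as All
open import Data.List.Relation.Unary.Any using (Any; here; there; any?; index)
import Data.List.Membership.DecPropositional as DecMembership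
open import Data.Nat using (ℕ; zero; suc; _+_; _≤_; _≤?_)
import Data.Nat.Properties as ℕ
open import Data.Product using (∃; ∃-syntax; _×_; _,_; proj₁; proj₂)
import Data.Product.Properties as Product
open import Data.Sum using (_⊎_; inj₁; inj₂)
open import Data.Vec using (Vec; []; _∷_; toList; fromList; lookup)
import Data.Vec as Vec
import Data.Vec.Properties as Vec
open import Data.Vec.Relation.Unary.Unique.Propositional using (Unique)
open import Data.Empty using (⊥-elim)
open import Function using (_∘_)
open import Level using (Level; _⊔_) renaming (suc to lsuc)
open import Relation.Binary.Definitions using (DecidableEquality)
open import Relation.Binary.PropositionalEquality using (_≡_; _≢_; refl; cong; sym; trans; subst)
open import Relation.Nullary using (Dec; yes; no; ¬_; ¬?)
open import Relation.Nullary.Decidable using (map′; _×-dec_; _⊎-dec_)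
open import Relation.Unary using (Pred; _∪_; _⊢_)

------------------------------------------------------------------------
-- Syntax

Var Const : Set
Var   = ℕ
Const = ℕ

record Predicate : Set where
  constructor predicate
  field
    name  : ℕ
    arity : ℕ
open Predicate public

record Atom (T : Set) : Set where
  constructor atom
  field
    pred : Predicate
    args : Vec T (arity pred)
open Atom public

mapAtom : ∀ {S T : Set} → (S → T) → Atom S → Atom T
mapAtom f (atom p ts) = atom p (Vec.map f ts)

vars : List (Atom Var) → List Var
vars = concatMap (toList ∘ args)

-- Rules are constant-free, and finite conjunctions of atoms are lists.  The
-- existential variables are the head variables that do not occur in the body.
record TGD : Set where
  constructor _⟶_
  field
    body : List (Atom Var)
    head : List (Atom Var)
open TGD public

Ontology : Set
Ontology = List TGD

_≟ᵖ_ : DecidableEquality Predicate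
predicate m k ≟ᵖ predicate n l =
  map′ (λ { (refl , refl) → refl }) (λ { refl → refl , refl }) ((m ℕ.≟ n) ×-dec (k ℕ.≟ l))

_≟ᵃ_ : DecidableEquality (Atom Var)
atom p us ≟ᵃ atom q vs with p ≟ᵖ q
... | no p≢q   = no λ { refl → p≢q refl }
... | yes refl = map′ (λ { refl → refl }) (λ { refl → refl }) (Vec.≡-dec ℕ._≟_ us vs)

_≟ᵗ_ : DecidableEquality TGD
(b ⟶ h) ≟ᵗ (b′ ⟶ h′) =
  map′ (λ { (refl , refl) → refl }) (λ { refl → refl , refl })
       (List.≡-dec _≟ᵃ_ b b′ ×-dec List.≡-dec _≟ᵃ_ h h′)

open DecMembership ℕ._≟_ using (_∈?_) public

frontier exvars : TGD → List Var
frontier σ = deduplicate ℕ._≟_ (filter (_∈? vars (body σ)) (vars (head σ)))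
exvars   σ = deduplicate ℕ._≟_ (filter (λ x → ¬? (x ∈? vars (body σ))) (vars (head σ)))

------------------------------------------------------------------------
-- Certain answers

data GroundTerm : Set where
  const : Const → GroundTerm
  null  : ℕ → GroundTerm

Instance : Set₁
Instance = Atom GroundTerm → Set

Database : Set
Database = List (Atom Const)

Holds : Instance → (Var → GroundTerm) → List (Atom Var) → Set
Holds I h = All (I ∘ mapAtom h)

Satisfies : Instance → TGD → Set
Satisfies I σ = ∀ h → Holds I h (body σ) →
  ∃[ h′ ] (∀ {x} → x ∈ vars (body σ) → h′ x ≡ h x) × Holds I h′ (head σ)

Model : Database → Ontology → Instance → Set
Model D Σ I = All (I ∘ mapAtom const) D × All (Satisfies I) Σ

record CQ (k : ℕ) : Set where
  field
    atoms  : List (Atom Var)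
    answer : Vec Var k
    safe   : All (_∈ vars atoms) (toList answer)
open CQ public

_∈answers_over_ : ∀ {k} → Vec Const k → CQ k → Instance → Set
c ∈answers q over I = ∃[ h ] Holds I h (atoms q) × Vec.map h (answer q) ≡ Vec.map const c

_∈cert[_,_,_] : ∀ {k} → Vec Const k → CQ k → Database → Ontology → Set₁
c ∈cert[ q , D , Σ ] = ∀ (I : Instance) → Model D Σ I → c ∈answers q over I

CertEvalDecidable : ∀ {ℓ} → Pred Ontology ℓ → Set (lsuc Level.zero ⊔ ℓ)
CertEvalDecidable C =
  ∀ Σ → C Σ → ∀ (D : Database) {k} (q : CQ k) (c : Vec Const k) → Dec (c ∈cert[ q , D , Σ ])

------------------------------------------------------------------------
-- Classes of ontologies

DatalogRule : Pred TGD _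
DatalogRule σ = exvars σ ≡ [] × ∃[ α ] head σ ≡ α ∷ []

Datalog : Pred Ontology _
Datalog = All DatalogRule

InclusionDependency : Pred TGD _
InclusionDependency σ =
  ∃[ α ] ∃[ β ] body σ ≡ α ∷ [] × head σ ≡ β ∷ [] × Unique (args α) × Unique (args β)

InclusionDependencies : Pred Ontology _
InclusionDependencies = All InclusionDependency

AfInds : Pred Ontology _
AfInds Σ =
  InclusionDependencies Σ ×
  All (λ σ → exvars σ ≡ []) Σ ×
  (∀ {σ τ α β} → σ ∈ Σ → τ ∈ Σ → α ∈ head σ → β ∈ body τ → pred α ≢ pred β)

------------------------------------------------------------------------
-- Derivability from propositional Horn clauses (conclusion , premises); only
-- used to decide the inductive predicates Affected and Problematic below.

module Horn {A : Set} (_≟_ : DecidableEquality A) where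

  open DecMembership _≟_ using () renaming (_∈?_ to _∈ᴬ?_)

  Clause : Set
  Clause = A × List A

  data Derivable (cs : List Clause) : A → Set where
    by : ∀ {a ps} → (a , ps) ∈ cs → (∀ {b} → b ∈ ps → Derivable cs b) → Derivable cs a

  private
    removed : ∀ {P : Clause → Set} {c} {R : List Clause} (p : Any P R) → c ∈ R →
              c ≡ proj₁ (find p) ⊎ c ∈ removeAt R (index p)
    removed (here _)  (here refl) = inj₁ refl
    removed (here _)  (there c∈)  = inj₂ c∈
    removed (there _) (here refl) = inj₂ (here refl)
    removed (there p) (there c∈) with removed p c∈
    ... | inj₁ eq = inj₁ eq
    ... | inj₂ c∈′ = inj₂ (there c∈′)

    kept : ∀ {c} (R : List Clause) i → c ∈ removeAt R i → c ∈ R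
    kept (_ ∷ R) Fin.zero    c∈          = there c∈
    kept (_ ∷ R) (Fin.suc i) (here refl) = here refl
    kept (_ ∷ R) (Fin.suc i) (there c∈)  = there (kept R i c∈)

  module _ (cs : List Clause) where

    private
      Closed : List A → Set
      Closed K = ∀ {a ps} → (a , ps) ∈ cs → All (_∈ K) ps → a ∈ K

      Fires : List A → Clause → Set
      Fires K c = All (_∈ K) (proj₂ c)

      saturate : ∀ n (K : List A) (R : List Clause) → length R ≡ n →
                 (∀ {a} → a ∈ K → Derivable cs a) →
                 (∀ {c} → c ∈ R → c ∈ cs) →
                 (∀ {c} → c ∈ cs → proj₁ c ∈ K ⊎ c ∈ R) →
                 ∃[ K′ ] (∀ {a} → a ∈ K′ → Derivable cs a) × Closed K′
      saturate n K R eq sound sub split with any? (λ c → all? (_∈ᴬ? K) (proj₂ c)) R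
      saturate n K R eq sound sub split | no none = K , sound , closed
        where
        closed : Closed K
        closed c∈ fires with split c∈
        ... | inj₁ a∈ = a∈
        ... | inj₂ c∈R = ⊥-elim (none (lose c∈R fires))
      saturate zero K [] eq sound sub split | yes ()
      saturate (suc n) K R eq sound sub split | yes p =
        saturate n (a ∷ K) (removeAt R (index p))
          (ℕ.suc-injective (trans (sym (List.length-removeAt′ R (index p))) eq))
          sound′ (sub ∘ kept R (index p)) split′
        where
        a = proj₁ (proj₁ (find p))
        sound′ : ∀ {b} → b ∈ a ∷ K → Derivable cs b
        sound′ (here refl) =
          by (sub (proj₁ (proj₂ (find p)))) (sound ∘ All.lookup (proj₂ (proj₂ (find p))))
        sound′ (there b∈)  = sound b∈
        split′ : ∀ {c} → c ∈ cs → proj₁ c ∈ a ∷ K ⊎ c ∈ removeAt R (index p)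
        split′ c∈ with split c∈
        ... | inj₁ b∈ = inj₁ (there b∈)
        ... | inj₂ c∈R with removed p c∈R
        ...   | inj₁ refl = inj₁ (here refl)
        ...   | inj₂ c∈R′ = inj₂ c∈R′

      complete : ∀ {K a} → Closed K → Derivable cs a → a ∈ K
      complete closed (by c∈ ds) = closed c∈ (All.tabulate (λ b∈ → complete closed (ds b∈)))

    derivable? : ∀ a → Dec (Derivable cs a)
    derivable? a with saturate (length cs) [] cs refl (λ ()) (λ c∈ → c∈) inj₂
    ... | K , sound , closed = map′ sound (complete closed) (a ∈ᴬ? K)

------------------------------------------------------------------------
-- Affected positions

Position : Set
Position = ∃[ p ] Fin (arity p)

_≟ᵒ_ : DecidableEquality Position
_≟ᵒ_ = Product.≡-dec _≟ᵖ_ Fin._≟_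

positions : Var → List (Atom Var) → List Position
positions x = concatMap λ α →
  map (pred α ,_) (filter (λ i → lookup (args α) i ℕ.≟ x) (allFin (arity (pred α))))

-- An existential variable is tagged with its rule, so that rules need not be
-- renamed apart.
ExVar : Set
ExVar = TGD × Var

existentials : Ontology → List ExVar
existentials = concatMap λ τ → map (τ ,_) (exvars τ)

-- Only meaningful for ζ ∈ existentials Σ, as in Harmful below.
data Affected (Σ : Ontology) : ExVar → Position → Set where
  existential : ∀ {τ z π} → π ∈ positions z (head τ) → Affected Σ (τ , z) π
  propagated  : ∀ {ζ σ x π} → σ ∈ Σ → x ∈ frontier σ → π ∈ positions x (head σ) →
                (∀ {ρ} → ρ ∈ positions x (body σ) → Affected Σ ζ ρ) → Affected Σ ζ π

affected? : ∀ Σ ζ π → Dec (Affected Σ ζ π)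
affected? Σ (τ , z) π = map′ to from (derivable? clauses π)
  where
  open Horn _≟ᵒ_

  rules : TGD → Var → List Clause
  rules σ x = map (_, positions x (body σ)) (positions x (head σ))

  base step clauses : List Clause
  base    = map (_, []) (positions z (head τ))
  step    = concatMap (λ σ → concatMap (rules σ) (frontier σ)) Σ
  clauses = base ++ step

  to : ∀ {π} → Derivable clauses π → Affected Σ (τ , z) π
  to (by c∈ ds) with ∈-++⁻ base c∈
  ... | inj₁ c∈base with _ , π∈ , refl ← ∈-map⁻ (_, []) c∈base = existential π∈
  ... | inj₂ c∈step
    with σ , σ∈ , c∈σ ← find (∈-concatMap⁻ (λ σ → concatMap (rules σ) (frontier σ)) {xs = Σ} c∈step)
    with x , x∈ , c∈x ← find (∈-concatMap⁻ (rules σ) {xs = frontier σ} c∈σ)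
    with _ , π∈ , refl ← ∈-map⁻ (_, positions x (body σ)) c∈x
    = propagated σ∈ x∈ π∈ (λ ρ∈ → to (ds ρ∈))

  from : ∀ {π} → Affected Σ (τ , z) π → Derivable clauses π
  from (existential π∈) = by (∈-++⁺ˡ (∈-map⁺ (_, []) π∈)) (λ ())
  from (propagated {σ = σ} {x = x} σ∈ x∈ π∈ as) =
    by (∈-++⁺ʳ base (∈-concatMap⁺ (λ σ → concatMap (rules σ) (frontier σ))
         (lose σ∈ (∈-concatMap⁺ (rules σ) (lose x∈ (∈-map⁺ (_, positions x (body σ)) π∈))))))
       (λ ρ∈ → from (as ρ∈))

------------------------------------------------------------------------
-- Problematic and safe atoms

module _ (Σ : Ontology) (σ : TGD) where

  -- Some ζ lies in aff(π) for every body position π of x.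
  Harmful Harmless Dangerous : Var → Set
  Harmful x   = Any (λ ζ → All (Affected Σ ζ) (positions x (body σ))) (existentials Σ)
  Harmless x  = ¬ Harmful x
  Dangerous x = x ∈ frontier σ × Harmful x

  data Problematic : Atom Var → Set where
    dangerous : ∀ {α x} → α ∈ body σ → x ∈ toList (args α) → Dangerous x → Problematic α
    shares    : ∀ {α β x} → α ∈ body σ → Problematic β →
                x ∈ toList (args α) → x ∈ toList (args β) → Harmful x → Problematic α

  harmful? : ∀ x → Dec (Harmful x)
  harmful? x = any? (λ ζ → all? (affected? Σ ζ) (positions x (body σ))) (existentials Σ)

  dangerous? : ∀ x → Dec (Dangerous x)
  dangerous? x = (x ∈? frontier σ) ×-dec harmful? x

  problematic? : ∀ α → Dec (Problematic α)
  problematic? α = map′ to from (derivable? clauses α)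
    where
    open Horn _≟ᵃ_

    HasDangerous : Atom Var → Set
    HasDangerous α = Any Dangerous (toList (args α))

    hasDangerous? : ∀ α → Dec (HasDangerous α)
    hasDangerous? α = any? dangerous? (toList (args α))

    Linked : Atom Var × Atom Var → Set
    Linked (α , β) = Any (λ x → x ∈ toList (args β) × Harmful x) (toList (args α))

    linked? : ∀ αβ → Dec (Linked αβ)
    linked? (α , β) = any? (λ x → (x ∈? toList (args β)) ×-dec harmful? x) (toList (args α))

    edge : Atom Var × Atom Var → Clause
    edge (α , β) = α , β ∷ []

    pairs : List (Atom Var × Atom Var)
    pairs = cartesianProduct (body σ) (body σ)

    base clauses : List Clause
    base    = map (_, []) (filter hasDangerous? (body σ))
    clauses = base ++ map edge (filter linked? pairs)

    to : ∀ {α} → Derivable clauses α → Problematic α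
    to (by c∈ ds) with ∈-++⁻ base c∈
    ... | inj₁ c∈base
      with _ , α∈′ , refl ← ∈-map⁻ (_, []) c∈base
      with α∈ , d ← ∈-filter⁻ hasDangerous? {xs = body σ} α∈′
      with _ , x∈ , dx ← find d
      = dangerous α∈ x∈ dx
    ... | inj₂ c∈edges
      with (α , β) , αβ∈′ , refl ← ∈-map⁻ edge c∈edges
      with αβ∈ , l ← ∈-filter⁻ linked? {xs = pairs} αβ∈′
      with α∈ , _ ← ∈-cartesianProduct⁻ (body σ) (body σ) αβ∈
      with _ , x∈α , x∈β , hx ← find l
      = shares α∈ (to (ds (here refl))) x∈α x∈β hx

    inBody : ∀ {α} → Problematic α → α ∈ body σ
    inBody (dangerous α∈ _ _)    = α∈
    inBody (shares α∈ _ _ _ _) = α∈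

    from : ∀ {α} → Problematic α → Derivable clauses α
    from (dangerous α∈ x∈ dx) =
      by (∈-++⁺ˡ (∈-map⁺ (_, []) (∈-filter⁺ hasDangerous? α∈ (lose x∈ dx)))) (λ ())
    from (shares α∈ pβ x∈α x∈β hx) =
      by (∈-++⁺ʳ base (∈-map⁺ edge (∈-filter⁺ linked?
           (∈-cartesianProduct⁺ α∈ (inBody pβ)) (lose x∈α (x∈β , hx)))))
         (λ { (here refl) → from pβ })

  p-atoms s-atoms : List (Atom Var)
  p-atoms = filter problematic? (body σ)
  s-atoms = filter (λ α → ¬? (problematic? α)) (body σ)

  HF bridge : List Var
  HF     = filter (λ x → (x ∈? frontier σ) ×-dec ¬? (harmful? x)) (vars s-atoms)
  bridge = deduplicate ℕ._≟_ (filter (_∈? vars p-atoms) (vars s-atoms) ++ HF)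

------------------------------------------------------------------------
-- The main part of an ontology

freshVar : TGD → Var
freshVar σ = suc (max 0 (vars (body σ) ++ vars (head σ)))

freshName : Ontology → ℕ
freshName = suc ∘ max 0 ∘ concatMap λ σ → map (name ∘ pred) (body σ ++ head σ)

-- Every occurrence of a variable of B other than its first one (seen collects
-- the variables met so far) is replaced by a new variable.  The variable v + i
-- is reserved for the i-th argument from here on.
separateArgs : ∀ {n} (B seen : List Var) (v : Var) → Vec Var n → Vec Var n
separateArgs B seen v []       = []
separateArgs B seen v (x ∷ xs) with (x ∈? B) ×-dec (x ∈? seen)
... | yes _ = v ∷ separateArgs B (x ∷ seen) (suc v) xs
... | no  _ = x ∷ separateArgs B (x ∷ seen) (suc v) xs

separate : (B seen : List Var) (v : Var) → List (Atom Var) → List (Atom Var)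
separate B seen v []                = []
separate B seen v (atom p xs ∷ αs) =
  atom p (separateArgs B seen v xs) ∷ separate B (toList xs ++ seen) (v + arity p) αs

indexOf : TGD → Ontology → ℕ
indexOf σ []      = 0
indexOf σ (τ ∷ Σ) with σ ≟ᵗ τ
... | yes _ = 0
... | no  _ = suc (indexOf σ Σ)

module _ (Σ : Ontology) (σ : TGD) where

  mainHead : List (Atom Var)
  mainHead = separate (bridge Σ σ) [] (freshVar σ) (head σ)

  -- A bridge variable with k occurrences in the head gets max 1 k arguments:
  -- itself, and the new variables standing for its repeated head occurrences.
  auxArgs : List Var
  auxArgs = bridge Σ σ ++ filter (freshVar σ ≤?_) (vars mainHead)

  auxPredicate : Predicate
  auxPredicate = predicate (freshName Σ + indexOf σ Σ) (length auxArgs)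

  mainRule : TGD
  mainRule = (atom auxPredicate (fromList auxArgs) ∷ p-atoms Σ σ) ⟶ mainHead

main : Ontology → Ontology
main Σ = map (mainRule Σ) Σ

Dyadic : ∀ {ℓ} → Pred Ontology ℓ → Pred Ontology ℓ
Dyadic C = C ∪ (main ⊢ C)

{-# OPTIONS --safe #-}

-- A Datalog ontology has no existential variables, so no position is affected,
-- every variable is harmless and every atom is safe.  Hence each rule of main Σ
-- has the Aux atom as its only body atom, and each head variable of the original
-- rule lies in the bridge, so that its repeated occurrences in the head are
-- separated.  The Aux predicates are fresh, so none of them occurs in a head.

module Submission where

open import Defs
open import Data.List using (List; []; _∷_; _++_; map; filter; deduplicate)
open import Data.List.Extrema.Nat using (xs≤max)
import Data.List.Properties as List
open import Data.List.Membership.Propositional using (_∈_; _∉_; lose)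
open import Data.List.Membership.Propositional.Properties
  using (∈-map⁺; ∈-map⁻; ∈-concatMap⁺; ∈-++⁺ˡ; ∈-++⁺ʳ; ∈-++⁻;
         ∈-filter⁺; ∈-filter⁻; ∈-deduplicate⁺; ∈-deduplicate⁻)
open import Data.List.Relation.Binary.Subset.Propositional using () renaming (_⊆_ to _⊆ˡ_)
open import Data.List.Relation.Unary.All using (All; []; _∷_)
import Data.List.Relation.Unary.All as All
import Data.List.Relation.Unary.All.Properties as All
open import Data.List.Relation.Unary.AllPairs using ([]; _∷_)
open import Data.List.Relation.Unary.Any using (here; there)
import Data.List.Relation.Unary.Unique.Propositional as List
import Data.List.Relation.Unary.Unique.Propositional.Properties as Unique
open import Data.List.Relation.Unary.Unique.DecPropositional.Properties using (deduplicate-!)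
open import Data.Nat using (suc; _+_; _≤_; _<_; _≤?_; s≤s)
import Data.Nat.Properties as ℕ
open import Data.Product using (_×_; _,_; proj₁; proj₂)
open import Data.Sum using (_⊎_; inj₁; inj₂)
import Data.Sum as Sum
open import Data.Vec using (Vec; []; _∷_; toList; fromList)
import Data.Vec.Properties as Vec
open import Data.Vec.Relation.Unary.All using ([]; _∷_) renaming (All to Allᵛ; map to mapᵛ)
import Data.Vec.Relation.Unary.All.Properties as Allᵛ
open import Data.Vec.Relation.Unary.AllPairs using ([]; _∷_)
open import Data.Vec.Relation.Unary.Unique.Propositional using (Unique)
open import Function using (_∘_)
open import Relation.Binary.PropositionalEquality
  using (_≡_; _≢_; refl; cong; sym; subst; ≢-sym)
open import Relation.Nullary using (yes; no; ¬_; ¬?)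
open import Relation.Nullary.Decidable using (_×-dec_)
open import Relation.Unary using (Pred; Decidable; _⊆_)

-- Preliminaries: distinctness, safe rules and freshness bounds.

toList⁻-Unique : ∀ {A : Set} {n} {xs : Vec A n} → List.Unique (toList xs) → Unique xs
toList⁻-Unique {xs = []}    []          = []
toList⁻-Unique {xs = _ ∷ _} (x∉ ∷ xs!) = Allᵛ.toList⁻ x∉ ∷ toList⁻-Unique xs!

toList⁺-Unique : ∀ {A : Set} {n} {xs : Vec A n} → Unique xs → List.Unique (toList xs)
toList⁺-Unique []          = []
toList⁺-Unique (x∉ ∷ xs!) = Allᵛ.toList⁺ x∉ ∷ toList⁺-Unique xs!

fromList-Unique : ∀ {A : Set} {xs : List A} → List.Unique xs → Unique (fromList xs)
fromList-Unique {xs = xs} xs! =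
  toList⁻-Unique (subst List.Unique (sym (Vec.toList∘fromList xs)) xs!)

vars-singleton : ∀ α → vars (α ∷ []) ≡ toList (args α)
vars-singleton α = List.++-identityʳ (toList (args α))

exvars≡[]⇒safe : ∀ σ → exvars σ ≡ [] → vars (head σ) ⊆ˡ vars (body σ)
exvars≡[]⇒safe σ eq {x} x∈head with x ∈? vars (body σ)
... | yes x∈body = x∈body
... | no  x∉body
  with () ← subst (x ∈_) eq (∈-deduplicate⁺ ℕ._≟_
              (∈-filter⁺ (λ x → ¬? (x ∈? vars (body σ))) x∈head x∉body))

safe⇒exvars≡[] : ∀ σ → vars (head σ) ⊆ˡ vars (body σ) → exvars σ ≡ []
safe⇒exvars≡[] σ safe = cong (deduplicate ℕ._≟_)
  (List.filter-none (λ x → ¬? (x ∈? vars (body σ)))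
    (All.tabulate λ x∈head x∉body → x∉body (safe x∈head)))

-- This is the shape of `bridge`: both of its parts are filters of `vars s-atoms`.
deduplicate-filters-⊆ : ∀ {P Q : Var → Set} (P? : Decidable P) (Q? : Decidable Q) xs →
  deduplicate ℕ._≟_ (filter P? xs ++ filter Q? xs) ⊆ˡ xs
deduplicate-filters-⊆ P? Q? xs =
  Sum.[ proj₁ ∘ ∈-filter⁻ P? , proj₁ ∘ ∈-filter⁻ Q? ]′ ∘ ∈-++⁻ (filter P? xs) ∘
  ∈-deduplicate⁻ ℕ._≟_ (filter P? xs ++ filter Q? xs)

all-main : ∀ {Σ} {P : TGD → Set} → (∀ {σ} → σ ∈ Σ → P (mainRule Σ σ)) → All P (main Σ)
all-main = All.map⁺ ∘ All.tabulate

existentials≡[] : ∀ {Σ} → All (λ σ → exvars σ ≡ []) Σ → existentials Σ ≡ []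
existentials≡[] []                           = refl
existentials≡[] (eq ∷ eqs) rewrite eq = existentials≡[] eqs

vars<freshVar : ∀ σ {x} → x ∈ vars (body σ) ++ vars (head σ) → x < freshVar σ
vars<freshVar σ x∈ = s≤s (All.lookup (xs≤max 0 _) x∈)

names<freshName : ∀ {Σ σ α} → σ ∈ Σ → α ∈ head σ → name (pred α) < freshName Σ
names<freshName {σ = σ} σ∈ α∈ =
  s≤s (All.lookup (xs≤max 0 _)
    (∈-concatMap⁺ (λ σ → map (name ∘ pred) (body σ ++ head σ))
      (lose σ∈ (∈-map⁺ (name ∘ pred) (∈-++⁺ʳ (body σ) α∈)))))

-- Separation of repeated arguments.

-- Invariant behind both distinctness of the new head and its coverage by the Aux atom. The
-- recursive call has `x` added to `seen` and starts from `suc v`, so its conclusion is stronger and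
-- is weakened here.
separateArgs-range : ∀ {n} B seen v (xs : Vec Var n) → Allᵛ (_∈ B) xs →
  Allᵛ (λ y → (y ∈ toList xs × y ∉ seen) ⊎ v ≤ y) (separateArgs B seen v xs)
separateArgs-range B seen v []       []       = []
separateArgs-range B seen v (x ∷ xs) (x∈B ∷ xs⊆B)
  with rest ← mapᵛ (Sum.map (λ { (y∈ , y∉) → there y∈ , y∉ ∘ there }) ℕ.<⇒≤)
                (separateArgs-range B (x ∷ seen) (suc v) xs xs⊆B)
  with (x ∈? B) ×-dec (x ∈? seen)
... | yes _   = inj₂ ℕ.≤-refl ∷ rest
-- As `x` lies in `B`, the test can only have failed because `x` was not seen before.
... | no  new = inj₁ (here refl , λ x∈seen → new (x∈B , x∈seen)) ∷ rest

-- Each output argument is compared with the later ones through the range of the recursive call,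
-- taken with `x ∷ seen` and `suc v`.
separateArgs-Unique : ∀ {n} B seen v (xs : Vec Var n) → Allᵛ (_∈ B) xs →
  Allᵛ (_< v) xs → Unique (separateArgs B seen v xs)
separateArgs-Unique B seen v []       []           []           = []
separateArgs-Unique B seen v (x ∷ xs) (x∈B ∷ xs⊆B) (x<v ∷ xs<v)
  with range ← separateArgs-range B (x ∷ seen) (suc v) xs xs⊆B
     | rest! ← separateArgs-Unique B (x ∷ seen) (suc v) xs xs⊆B (mapᵛ ℕ.m<n⇒m<1+n xs<v)
  with (x ∈? B) ×-dec (x ∈? seen)
... | yes _ = mapᵛ v≢ range ∷ rest!
  where
  -- Later original arguments lie below `v`, and later new ones start at `suc v`.
  v≢ : ∀ {y} → (y ∈ toList xs × y ∉ x ∷ seen) ⊎ v < y → v ≢ y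
  v≢ (inj₁ (y∈ , _)) = ≢-sym (ℕ.<⇒≢ (All.lookup (Allᵛ.toList⁺ xs<v) y∈))
  v≢ (inj₂ v<y)      = ℕ.<⇒≢ v<y
... | no _ = mapᵛ x≢ range ∷ rest!
  where
  -- Later original arguments avoid `x`, which is now seen, and new ones exceed `v`, hence `x`.
  x≢ : ∀ {y} → (y ∈ toList xs × y ∉ x ∷ seen) ⊎ v < y → x ≢ y
  x≢ (inj₁ (_ , y∉)) = y∉ ∘ here ∘ sym
  x≢ (inj₂ v<y)      = ℕ.<⇒≢ (ℕ.<-trans x<v v<y)

separate-pred : ∀ B seen v αs {β} → β ∈ separate B seen v αs → pred β ∈ map pred αs
separate-pred B seen v (atom p xs ∷ αs) (here refl) = here refl
separate-pred B seen v (atom p xs ∷ αs) (there β∈)  =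
  there (separate-pred B (toList xs ++ seen) (v + _) αs β∈)

-- The main part of an ontology without existential variables.

module _ {Σ : Ontology} (noEx : All (λ σ → exvars σ ≡ []) Σ) where

  -- The witness of `Harmful` would come from the empty list `existentials Σ`. This also settles
  -- variables without body positions, for which the inner `All` is vacuous.
  harmless : ∀ σ x → Harmless Σ σ x
  harmless σ x harm rewrite existentials≡[] noEx with () ← harm

  unproblematic : ∀ σ {α} → ¬ Problematic Σ σ α
  unproblematic σ (dangerous _ _ (_ , harm)) = harmless σ _ harm
  unproblematic σ (shares _ _ _ _ harm)      = harmless σ _ harm

  p-atoms≡[] : ∀ σ → p-atoms Σ σ ≡ []
  p-atoms≡[] σ = List.filter-none (problematic? Σ σ) {body σ} (All.tabulate λ _ → unproblematic σ)

  s-atoms≡body : ∀ σ → s-atoms Σ σ ≡ body σ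
  s-atoms≡body σ =
    List.filter-all (λ α → ¬? (problematic? Σ σ α)) {body σ} (All.tabulate λ _ → unproblematic σ)

  head⊆bridge : ∀ {σ} → σ ∈ Σ → vars (head σ) ⊆ˡ bridge Σ σ
  head⊆bridge {σ} σ∈ {x} x∈head =
    -- Membership comes through `HF`: there are no problematic atoms with which to share variables.
    ∈-deduplicate⁺ ℕ._≟_ (∈-++⁺ʳ (filter (_∈? vars (p-atoms Σ σ)) (vars (s-atoms Σ σ)))
      (∈-filter⁺ (λ x → (x ∈? frontier σ) ×-dec ¬? (harmful? Σ σ x))
        (subst (λ αs → x ∈ vars αs) (sym (s-atoms≡body σ)) x∈body)
        (∈-deduplicate⁺ ℕ._≟_ (∈-filter⁺ (_∈? vars (body σ)) x∈head x∈body) , harmless σ x)))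
    where x∈body = exvars≡[]⇒safe σ (All.lookup noEx σ∈) x∈head

  bridge⊆body : ∀ σ → bridge Σ σ ⊆ˡ vars (body σ)
  bridge⊆body σ {x} = subst (λ αs → x ∈ vars αs) (s-atoms≡body σ) ∘
    deduplicate-filters-⊆ (_∈? vars (p-atoms Σ σ))
      (λ x → (x ∈? frontier σ) ×-dec ¬? (harmful? Σ σ x)) (vars (s-atoms Σ σ))

  auxAtom : TGD → Atom Var
  auxAtom σ = atom (auxPredicate Σ σ) (fromList (auxArgs Σ σ))

  body-mainRule : ∀ σ → body (mainRule Σ σ) ≡ auxAtom σ ∷ []
  body-mainRule σ = cong (auxAtom σ ∷_) (p-atoms≡[] σ)

  -- `freshVar σ` divides the two halves: bridge variables are body variables and lie below it,
  -- while the filter keeps only head variables at or above it.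
  auxArgs-Unique : ∀ σ → List.Unique (vars (mainHead Σ σ)) → List.Unique (auxArgs Σ σ)
  auxArgs-Unique σ head! = Unique.++⁺ (deduplicate-! ℕ._≟_ _)
    (Unique.filter⁺ (freshVar σ ≤?_) head!)
    λ (x∈bridge , x∈new) → ℕ.<⇒≱ (vars<freshVar σ (∈-++⁺ˡ (bridge⊆body σ x∈bridge)))
      (proj₂ (∈-filter⁻ (freshVar σ ≤?_) {xs = vars (mainHead Σ σ)} x∈new))

  module _ {b α} (σ∈ : (b ⟶ (α ∷ [])) ∈ Σ) where

    private
      σ = b ⟶ (α ∷ [])

      args⊆bridge : Allᵛ (_∈ bridge Σ σ) (args α)
      args⊆bridge = Allᵛ.toList⁻ (All.tabulate (head⊆bridge σ∈ ∘ ∈-++⁺ˡ))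

    -- For a singleton head, `mainHead` computes to one atom with these arguments.
    separatedArgs : Vec Var (arity (pred α))
    separatedArgs = separateArgs (bridge Σ σ) [] (freshVar σ) (args α)

    separatedArgs-Unique : Unique separatedArgs
    separatedArgs-Unique = separateArgs-Unique (bridge Σ σ) [] (freshVar σ) (args α) args⊆bridge
      (Allᵛ.toList⁻ (All.tabulate (vars<freshVar σ ∘ ∈-++⁺ʳ (vars b) ∘ ∈-++⁺ˡ)))

    -- An argument kept by the separation is an original head variable, hence in the bridge; any
    -- other is at least `freshVar σ` and passes the filter in `auxArgs`.
    mainHead⊆auxArgs : vars (mainHead Σ σ) ⊆ˡ auxArgs Σ σ
    mainHead⊆auxArgs {x} x∈ =
      Sum.[ (λ (x∈args , _) → ∈-++⁺ˡ (head⊆bridge σ∈ (∈-++⁺ˡ x∈args)))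
          , (λ fresh≤x → ∈-++⁺ʳ (bridge Σ σ) (∈-filter⁺ (freshVar σ ≤?_) x∈ fresh≤x)) ]′
        (All.lookup
          (Allᵛ.toList⁺ (separateArgs-range (bridge Σ σ) [] (freshVar σ) (args α) args⊆bridge))
          (subst (x ∈_) (vars-singleton (atom (pred α) separatedArgs)) x∈))

    mainRule-exvars : exvars (mainRule Σ σ) ≡ []
    mainRule-exvars = safe⇒exvars≡[] (mainRule Σ σ) λ {x} x∈ → ∈-++⁺ˡ
      (subst (x ∈_) (sym (Vec.toList∘fromList (auxArgs Σ σ))) (mainHead⊆auxArgs x∈))

    mainRule-InclusionDependency : InclusionDependency (mainRule Σ σ)
    mainRule-InclusionDependency =
      auxAtom σ , atom (pred α) separatedArgs , body-mainRule σ , refl ,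
      fromList-Unique (auxArgs-Unique σ
        (subst List.Unique (sym (vars-singleton (atom (pred α) separatedArgs)))
          (toList⁺-Unique separatedArgs-Unique))) ,
      separatedArgs-Unique

  mainHead-names : ∀ {σ α} → σ ∈ Σ → α ∈ mainHead Σ σ → name (pred α) < freshName Σ
  mainHead-names {σ} σ∈ α∈ = let _ , γ∈ , eq = ∈-map⁻ pred α∈′ in
    subst (λ p → name p < freshName Σ) (sym eq) (names<freshName σ∈ γ∈)
    where α∈′ = separate-pred (bridge Σ σ) [] (freshVar σ) (head σ) α∈

  mainBody-names : ∀ σ {β} → β ∈ body (mainRule Σ σ) → freshName Σ ≤ name (pred β)
  mainBody-names σ = All.lookup (subst (All (λ β → freshName Σ ≤ name (pred β)))
    (sym (body-mainRule σ)) (ℕ.m≤m+n (freshName Σ) (indexOf σ Σ) ∷ []))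

  -- `freshName Σ` is a threshold: separation keeps head predicates, whose names lie strictly below
  -- it, while Aux names are it plus an index.
  main-disjoint : ∀ {σ τ α β} → σ ∈ main Σ → τ ∈ main Σ →
                  α ∈ head σ → β ∈ body τ → pred α ≢ pred β
  main-disjoint σ∈ τ∈ α∈ β∈ eq = ℕ.<⇒≱ (All.lookup (All.lookup heads σ∈) α∈)
    (subst (λ p → freshName Σ ≤ name p) (sym eq) (All.lookup (All.lookup bodies τ∈) β∈))
    where
    heads : All (λ σ → All (λ α → name (pred α) < freshName Σ) (head σ)) (main Σ)
    heads = all-main λ σ∈ → All.tabulate (mainHead-names σ∈)

    bodies : All (λ τ → All (λ β → freshName Σ ≤ name (pred β)) (body τ)) (main Σ)
    bodies = all-main λ {τ} _ → All.tabulate (mainBody-names τ)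

-- Datalog ontologies.

main-AfInds : ∀ {Σ} → Datalog Σ → AfInds (main Σ)
main-AfInds {Σ} datalog =
  all-main {P = InclusionDependency} (λ σ∈ → inclusion σ∈ (All.lookup datalog σ∈)) ,
  all-main {P = λ σ → exvars σ ≡ []} (λ σ∈ → noExvars σ∈ (All.lookup datalog σ∈)) ,
  main-disjoint noEx
  where
  noEx : All (λ σ → exvars σ ≡ []) Σ
  noEx = All.map proj₁ datalog

  inclusion : ∀ {σ} → σ ∈ Σ → DatalogRule σ → InclusionDependency (mainRule Σ σ)
  -- Splitting the rule lets `refl` turn its head into a literal singleton, as the results on
  -- single-atom heads require.
  inclusion {_ ⟶ _} σ∈ (_ , _ , refl) = mainRule-InclusionDependency noEx σ∈

  noExvars : ∀ {σ} → σ ∈ Σ → DatalogRule σ → exvars (mainRule Σ σ) ≡ []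
  noExvars {_ ⟶ _} σ∈ (_ , _ , refl) = mainRule-exvars noEx σ∈

mainTheorem9 : ∀ {ℓ} (C : Pred Ontology ℓ) →
    CertEvalDecidable C → AfInds ⊆ C → Datalog ⊆ Dyadic C
mainTheorem9 C _ AfInds⊆C datalog = inj₂ (AfInds⊆C (main-AfInds datalog))
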